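{- Let $\Gamma \vdash \phi$ be an $\mathcal{L}_{\Box\Diamond}$-consecution. Then $\Gamma \vdash_{\mathsf{IM}} \phi$ if and only if $\Gamma^t \vdash_{\mathsf{IK}_2} \phi^t$.
   Context: $\mathcal{L}_{\Box\Diamond}$ is the language $\phi ::= p_i \mid \bot \mid \phi\wedge\phi \mid \phi\vee\phi \mid \phi\to\phi \mid \Box\phi \mid \Diamond\phi$. $\mathsf{IM}$ is the set of consecutions $\Gamma\vdash\phi$ such that the standard translations satisfy $\mathrm{st}_x(\Gamma)\models\mathrm{st}_x(\phi)$ in intuitionistic two-sorted first-order logic with sorts for worlds and neighbourhoods and predicates $\mathsf{N}$, $\mathsf{E}$, $\mathsf{P}_i$, where $\mathrm{st}_x(\Box\phi) = \exists a(x\mathsf{N}a \wedge \forall y(a\mathsf{E}y \to \mathrm{st}_y(\phi)))$ and $\mathrm{st}_x(\Diamond\phi) = \forall a(x\mathsf{N}a \to \exists y(a\mathsf{E}y\wedge \mathrm{st}_y(\phi)))$; equivalently, $\mathsf{IM}$ is axiomatised by intuitionistic logic plus $(\Box p\wedge\Diamond\neg p)\to\bot$ and $(\Box\top\to\Diamond p)\to\Diamond p$ with modus ponens and the monotonicity rules for $\Box$ and $\Diamond$. $\mathsf{IK}_2$ is the bimodal version (modalities $\Box_N,\Diamond_N,\Box_{\ni},\Diamond_{\ni}$) of Fischer Servi/Simpson's intuitionistic modal logic $\mathsf{IK}$: intuitionistic logic plus, for each index $j$, $\Box_j(p\to q)\to(\Box_jp\to\Box_jq)$, $\Box_j(p\to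 q)\to(\Diamond_jp\to\Diamond_jq)$, $\neg\Diamond_j\bot$, $\Diamond_j(p\vee q)\to(\Diamond_jp\vee\Diamond_jq)$, $(\Diamond_jp\to\Box_jq)\to\Box_j(p\to q)$, with modus ponens and necessitation (from $\emptyset\vdash\phi$ infer $\Gamma\vdash\Box_j\phi$). The translation $(-)^t:\mathcal{L}_{\Box\Diamond}\to\mathcal{L}_2$ fixes propositional letters and $\bot$, commutes with $\wedge,\vee,\to$, and sets $(\Box\phi)^t = \Diamond_N\Box_{\ni}\phi^t$, $(\Diamond\phi)^t = \Box_N\Diamond_{\ni}\phi^t$; $\Gamma^t = \{\psi^t \mid \psi\in\Gamma\}$. -}

module Defs where

open import Data.Nat using (ℕ)
open import Data.Product using (Σ; _×_)
open import Relation.Binary.PropositionalEquality using (_≡_)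
import Data.Empty as E

data Fm (M : Set) : Set where
  var  : ℕ → Fm M
  ⊥'   : Fm M
  _∧'_ : Fm M → Fm M → Fm M
  _∨'_ : Fm M → Fm M → Fm M
  _⇒_  : Fm M → Fm M → Fm M
  mod  : M → Fm M → Fm M

infixr 6 _∧'_
infixr 5 _∨'_
infixr 4 _⇒_

¬' : {M : Set} → Fm M → Fm M
¬' φ = φ ⇒ ⊥'

⊤' : {M : Set} → Fm M
⊤' = ⊥' ⇒ ⊥'

FmSet : Set → Set₁
FmSet M = Fm M → Set

∅ : {M : Set} → FmSet M
∅ _ = E.⊥

data IPC {M : Set} : Fm M → Set where
  k    : ∀ φ ψ → IPC (φ ⇒ ψ ⇒ φ)
  s    : ∀ φ ψ χ → IPC ((φ ⇒ ψ ⇒ χ) ⇒ (φ ⇒ ψ) ⇒ φ ⇒ χ)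
  ∧e₁  : ∀ φ ψ → IPC (φ ∧' ψ ⇒ φ)
  ∧e₂  : ∀ φ ψ → IPC (φ ∧' ψ ⇒ ψ)
  ∧i   : ∀ φ ψ → IPC (φ ⇒ ψ ⇒ φ ∧' ψ)
  ∨i₁  : ∀ φ ψ → IPC (φ ⇒ φ ∨' ψ)
  ∨i₂  : ∀ φ ψ → IPC (ψ ⇒ φ ∨' ψ)
  ∨e   : ∀ φ ψ χ → IPC ((φ ⇒ χ) ⇒ (ψ ⇒ χ) ⇒ φ ∨' ψ ⇒ χ)
  efq  : ∀ φ → IPC (⊥' ⇒ φ)

data M1 : Set where
  □ ◇ : M1

L□◇ : Set
L□◇ = Fm M1

infix 3 _⊢IM_

data _⊢IM_ (Γ : FmSet M1) : L□◇ → Set where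
  ipc   : ∀ {φ} → IPC φ → Γ ⊢IM φ
  hyp   : ∀ {φ} → Γ φ → Γ ⊢IM φ
  ax□◇  : ∀ φ → Γ ⊢IM (mod □ φ ∧' mod ◇ (¬' φ)) ⇒ ⊥'
  ax⊤◇  : ∀ φ → Γ ⊢IM (mod □ ⊤' ⇒ mod ◇ φ) ⇒ mod ◇ φ
  mp    : ∀ {φ ψ} → Γ ⊢IM φ ⇒ ψ → Γ ⊢IM φ → Γ ⊢IM ψ
  mon□  : ∀ {φ ψ} → ∅ ⊢IM φ ⇒ ψ → Γ ⊢IM mod □ φ ⇒ mod □ ψ
  mon◇  : ∀ {φ ψ} → ∅ ⊢IM φ ⇒ ψ → Γ ⊢IM mod ◇ φ ⇒ mod ◇ ψ

data Idx : Set where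
  N ∋ : Idx

data M2 : Set where
  box dia : Idx → M2

L2 : Set
L2 = Fm M2

□[_] : Idx → L2 → L2
□[ j ] φ = mod (box j) φ

◇[_] : Idx → L2 → L2
◇[ j ] φ = mod (dia j) φ

infix 3 _⊢IK2_

data _⊢IK2_ (Γ : FmSet M2) : L2 → Set where
  ipc   : ∀ {φ} → IPC φ → Γ ⊢IK2 φ
  hyp   : ∀ {φ} → Γ φ → Γ ⊢IK2 φ
  axK   : ∀ j φ ψ → Γ ⊢IK2 □[ j ] (φ ⇒ ψ) ⇒ □[ j ] φ ⇒ □[ j ] ψ
  axK◇  : ∀ j φ ψ → Γ ⊢IK2 □[ j ] (φ ⇒ ψ) ⇒ ◇[ j ] φ ⇒ ◇[ j ] ψ
  axN◇  : ∀ j → Γ ⊢IK2 ¬' (◇[ j ] ⊥')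
  ax◇∨  : ∀ j φ ψ → Γ ⊢IK2 ◇[ j ] (φ ∨' ψ) ⇒ ◇[ j ] φ ∨' ◇[ j ] ψ
  axFS  : ∀ j φ ψ → Γ ⊢IK2 (◇[ j ] φ ⇒ □[ j ] ψ) ⇒ □[ j ] (φ ⇒ ψ)
  mp    : ∀ {φ ψ} → Γ ⊢IK2 φ ⇒ ψ → Γ ⊢IK2 φ → Γ ⊢IK2 ψ
  nec   : ∀ j {φ} → ∅ ⊢IK2 φ → Γ ⊢IK2 □[ j ] φ

_ᵗ : L□◇ → L2
var i ᵗ      = var i
⊥' ᵗ         = ⊥'
(φ ∧' ψ) ᵗ   = φ ᵗ ∧' ψ ᵗ
(φ ∨' ψ) ᵗ   = φ ᵗ ∨' ψ ᵗ
(φ ⇒ ψ) ᵗ    = φ ᵗ ⇒ ψ ᵗ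
mod □ φ ᵗ    = ◇[ N ] (□[ ∋ ] (φ ᵗ))
mod ◇ φ ᵗ    = □[ N ] (◇[ ∋ ] (φ ᵗ))

_ᵗˢ : FmSet M1 → FmSet M2
(Γ ᵗˢ) χ = Σ L□◇ (λ ψ → Γ ψ × (ψ ᵗ ≡ χ))

{-# OPTIONS --safe #-}
-- Faithfulness of the translation is shown by a two-sorted model of IK₂ built from the
-- Lindenbaum preorder of IM.  Worlds are formulas d, and the denotations over worlds form the
-- MacNeille completion of that preorder.  A neighbourhood is a pair (a , i): it is included in
-- the truth set of a and meets exactly those x with a ∧ x ≰ i; it grows as i decreases.  That a
-- world is not related to (a , i) has the value □a ⇒ ◇(a ⇒ i).  Hence □a ∧ ◇¬a ≤ ⊥ says that
-- the maximal neighbourhood (a , ⊥) is related to all worlds below □a, and by the other axiom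
-- of IM the neighbourhood (⊤ , b), which misses b, is unrelated to d only if d ≤ ◇b.  So the two
-- axioms are what makes φᵗ denote the principal ideal of φ.
-- The argument is classical; it is made constructive by Friedman's trick of reading the
-- metalogical falsity as an arbitrary set R, chosen at the end as the derivability to be proved.
module Submission where

open import Defs
open import Data.Empty using (⊥-elim)
open import Data.Product using (Σ; _×_; _,_; proj₁; proj₂)
open import Data.Sum using (_⊎_; inj₁; inj₂; [_,_])
open import Data.Unit using (⊤; tt)
open import Function.Base using (id; _∘_)
open import Function.Bundles using (_⇔_; mk⇔)
open import Relation.Binary.PropositionalEquality using (refl)

-- Combinators for intuitionistic propositional logic

module Hilbert {M : Set} (T : Fm M → Set)
               (ax : ∀ {φ} → IPC φ → T φ)
               (mp : ∀ {φ ψ} → T (φ ⇒ ψ) → T φ → T ψ) where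

  const⇒ : ∀ {φ ψ} → T ψ → T (φ ⇒ ψ)
  const⇒ t = mp (ax (k _ _)) t

  ap⇒ : ∀ {φ ψ χ} → T (φ ⇒ ψ ⇒ χ) → T (φ ⇒ ψ) → T (φ ⇒ χ)
  ap⇒ t u = mp (mp (ax (s _ _ _)) t) u

  id⇒ : ∀ {φ} → T (φ ⇒ φ)
  id⇒ {φ} = ap⇒ (ax (k φ (φ ⇒ φ))) (ax (k φ φ))

  infixr 9 _⨾_
  _⨾_ : ∀ {φ ψ χ} → T (φ ⇒ ψ) → T (ψ ⇒ χ) → T (φ ⇒ χ)
  t ⨾ u = ap⇒ (const⇒ u) t

  π₁ : ∀ {φ ψ} → T (φ ∧' ψ ⇒ φ)
  π₁ = ax (∧e₁ _ _)

  π₂ : ∀ {φ ψ} → T (φ ∧' ψ ⇒ ψ)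
  π₂ = ax (∧e₂ _ _)

  ⟨_,_⟩ : ∀ {φ ψ χ} → T (φ ⇒ ψ) → T (φ ⇒ χ) → T (φ ⇒ ψ ∧' χ)
  ⟨ t , u ⟩ = ap⇒ (t ⨾ ax (∧i _ _)) u

  case⇒ : ∀ {φ ψ χ} → T (φ ⇒ χ) → T (ψ ⇒ χ) → T (φ ∨' ψ ⇒ χ)
  case⇒ t u = mp (mp (ax (∨e _ _ _)) t) u

  uncurry⇒ : ∀ {φ ψ χ} → T (φ ⇒ ψ ⇒ χ) → T (φ ∧' ψ ⇒ χ)
  uncurry⇒ t = ap⇒ (π₁ ⨾ t) π₂

  curry⇒ : ∀ {φ ψ χ} → T (φ ∧' ψ ⇒ χ) → T (φ ⇒ ψ ⇒ χ)
  curry⇒ t = ax (∧i _ _) ⨾ mp (ax (s _ _ _)) (const⇒ t)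

  flip⇒ : ∀ {φ ψ χ} → T (φ ⇒ ψ ⇒ χ) → T (ψ ⇒ φ ⇒ χ)
  flip⇒ t = curry⇒ (ap⇒ (π₂ ⨾ t) π₁)

  eval⇒ : ∀ {φ ψ} → T (φ ⇒ (φ ⇒ ψ) ⇒ ψ)
  eval⇒ = flip⇒ id⇒

-- From IM to IK₂

weakenIM : ∀ {Γ Δ φ} → (∀ {ψ} → Γ ψ → Δ ψ) → Γ ⊢IM φ → Δ ⊢IM φ
weakenIM f (ipc a)    = ipc a
weakenIM f (hyp h)    = hyp (f h)
weakenIM f (ax□◇ φ)   = ax□◇ φ
weakenIM f (ax⊤◇ φ)   = ax⊤◇ φ
weakenIM f (mp t u)   = mp (weakenIM f t) (weakenIM f u)
weakenIM f (mon□ t)   = mon□ t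
weakenIM f (mon◇ t)   = mon◇ t

weakenIK2 : ∀ {Γ Δ φ} → (∀ {ψ} → Γ ψ → Δ ψ) → Γ ⊢IK2 φ → Δ ⊢IK2 φ
weakenIK2 f (ipc a)       = ipc a
weakenIK2 f (hyp h)       = hyp (f h)
weakenIK2 f (axK j φ ψ)   = axK j φ ψ
weakenIK2 f (axK◇ j φ ψ)  = axK◇ j φ ψ
weakenIK2 f (axN◇ j)      = axN◇ j
weakenIK2 f (ax◇∨ j φ ψ)  = ax◇∨ j φ ψ
weakenIK2 f (axFS j φ ψ)  = axFS j φ ψ
weakenIK2 f (mp t u)      = mp (weakenIK2 f t) (weakenIK2 f u)
weakenIK2 f (nec j t)     = nec j t

IPCᵗ : ∀ {φ} → IPC φ → IPC (φ ᵗ)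
IPCᵗ (k _ _)    = k _ _
IPCᵗ (s _ _ _)  = s _ _ _
IPCᵗ (∧e₁ _ _)  = ∧e₁ _ _
IPCᵗ (∧e₂ _ _)  = ∧e₂ _ _
IPCᵗ (∧i _ _)   = ∧i _ _
IPCᵗ (∨i₁ _ _)  = ∨i₁ _ _
IPCᵗ (∨i₂ _ _)  = ∨i₂ _ _
IPCᵗ (∨e _ _ _) = ∨e _ _ _
IPCᵗ (efq _)    = efq _

open module IK2 {Γ} = Hilbert (Γ ⊢IK2_) ipc mp

□-mono : ∀ {Γ} j {φ ψ} → ∅ ⊢IK2 φ ⇒ ψ → Γ ⊢IK2 □[ j ] φ ⇒ □[ j ] ψ
□-mono j t = mp (axK j _ _) (nec j t)

◇-mono : ∀ {Γ} j {φ ψ} → ∅ ⊢IK2 φ ⇒ ψ → Γ ⊢IK2 ◇[ j ] φ ⇒ ◇[ j ] ψ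
◇-mono j t = mp (axK◇ j _ _) (nec j t)

□-◇-incompatible : ∀ {Γ} j {φ ψ} → ∅ ⊢IK2 ψ ⇒ φ ⇒ ⊥' → Γ ⊢IK2 □[ j ] ψ ⇒ ◇[ j ] φ ⇒ ⊥'
□-◇-incompatible j t =
  □-mono j t ⨾ axK◇ j _ _ ⨾ curry⇒ (uncurry⇒ id⇒ ⨾ axN◇ j)

IM⇒IK2 : ∀ {Γ φ} → Γ ⊢IM φ → (Γ ᵗˢ) ⊢IK2 φ ᵗ

∅IM⇒IK2 : ∀ {φ} → ∅ ⊢IM φ → ∅ ⊢IK2 φ ᵗ
∅IM⇒IK2 t = weakenIK2 (λ h → ⊥-elim (proj₁ (proj₂ h))) (IM⇒IK2 t)

IM⇒IK2 (ipc a)   = ipc (IPCᵗ a)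
IM⇒IK2 (hyp h)   = hyp (_ , h , refl)
-- The inner use says that no neighbourhood is included in `φ` and meets its negation; the outer use
-- carries this along `N`.
IM⇒IK2 (ax□◇ φ)  =
  uncurry⇒ (flip⇒ (□-◇-incompatible N (flip⇒ (□-◇-incompatible ∋ eval⇒))))
-- Fischer Servi leaves an implication under `□[ N ]` whose antecedent is a theorem by
-- necessitation.
IM⇒IK2 (ax⊤◇ φ)  =
  axFS N _ _ ⨾ □-mono N (mp eval⇒ (nec ∋ id⇒))
IM⇒IK2 (mp t u)  = mp (IM⇒IK2 t) (IM⇒IK2 u)
IM⇒IK2 (mon□ t)  = ◇-mono N (□-mono ∋ (∅IM⇒IK2 t))
IM⇒IK2 (mon◇ t)  = □-mono N (◇-mono ∋ (∅IM⇒IK2 t))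

-- The preorder of IM and the two-sorted model

module Model (R : Set) where

  ¬¬_ : Set → Set
  ¬¬ X = (X → R) → R

  module H = Hilbert (λ φ → ¬¬ (∅ ⊢IM φ)) (λ a c → c (ipc a)) (λ t u c → t λ t → u λ u → c (mp t u))
  open H using () renaming
    (id⇒ to ≤-refl; _⨾_ to _⨟_; π₁ to ∧≤ˡ; π₂ to ∧≤ʳ; ⟨_,_⟩ to ∧-glb; case⇒ to ∨-lub;
     uncurry⇒ to uncurry≤; curry⇒ to curry≤; const⇒ to const≤)

  infix 3 _≤_
  _≤_ : L□◇ → L□◇ → Set
  d ≤ c = ¬¬ (∅ ⊢IM d ⇒ c)

  ≤-stable : ∀ {d c} → ¬¬ (d ≤ c) → d ≤ c
  ≤-stable t c = t λ u → u c

  ⊥≤ : ∀ {c} → ⊥' ≤ c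
  ⊥≤ = λ c → c (ipc (efq _))

  □≤ : ∀ {a b} → a ≤ b → mod □ a ≤ mod □ b
  □≤ t c = t (c ∘ mon□)

  ◇≤ : ∀ {a b} → a ≤ b → mod ◇ a ≤ mod ◇ b
  ◇≤ t c = t (c ∘ mon◇)

  data Pt : Set where
    world : L□◇ → Pt
    nbhd  : L□◇ → L□◇ → Pt

  infix 3 _⊑_
  data _⊑_ : Pt → Pt → Set where
    w : ∀ {d e} → d ≤ e → world d ⊑ world e
    n : ∀ {a i j} → i ≤ j → nbhd a i ⊑ nbhd a j

  ⊑-refl : ∀ {p} → p ⊑ p
  ⊑-refl {world d}  = w ≤-refl
  ⊑-refl {nbhd a i} = n ≤-refl

  ⊑-trans : ∀ {p q r} → p ⊑ q → q ⊑ r → p ⊑ r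
  ⊑-trans (w t) (w u) = w (t ⨟ u)
  ⊑-trans (n t) (n u) = n (t ⨟ u)

  -- At worlds, `∨'` and `◇[ N ]` are joins in the completion, stated through all upper bounds `c`.
  -- For `◇[ N ]` it suffices to test `(a , ⊥')`, which is `⊑` every `(a , i)`. `N` starts only at
  -- worlds and `∋` only at neighbourhoods; elsewhere boxes hold and diamonds are falsity.
  ⟦_⟧ : L2 → Pt → Set
  ⟦ var i ⟧         (world d)  = d ≤ var i
  ⟦ var i ⟧         (nbhd a j) = ⊤
  ⟦ ⊥' ⟧            (world d)  = d ≤ ⊥'
  ⟦ ⊥' ⟧            (nbhd a i) = R
  ⟦ φ ∧' ψ ⟧        p          = ⟦ φ ⟧ p × ⟦ ψ ⟧ p
  ⟦ φ ∨' ψ ⟧        (world d)  = ∀ c → (∀ x → ⟦ φ ⟧ (world x) → x ≤ c) →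
                                       (∀ x → ⟦ ψ ⟧ (world x) → x ≤ c) → d ≤ c
  ⟦ φ ∨' ψ ⟧        (nbhd a i) = ¬¬ (⟦ φ ⟧ (nbhd a i) ⊎ ⟦ ψ ⟧ (nbhd a i))
  ⟦ φ ⇒ ψ ⟧         p          = ∀ {q} → q ⊑ p → ⟦ φ ⟧ q → ⟦ ψ ⟧ q
  ⟦ mod (box N) φ ⟧ (world d)  = ∀ a i → (⟦ φ ⟧ (nbhd a i) → R) → d ∧' mod □ a ≤ mod ◇ (a ⇒ i)
  ⟦ mod (box N) φ ⟧ (nbhd a i) = ⊤
  ⟦ mod (box ∋) φ ⟧ (world d)  = ⊤
  ⟦ mod (box ∋) φ ⟧ (nbhd a i) = ⟦ φ ⟧ (world a)
  ⟦ mod (dia N) φ ⟧ (world d)  = ∀ c → (∀ a → ⟦ φ ⟧ (nbhd a ⊥') → mod □ a ≤ c) → d ≤ c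
  ⟦ mod (dia N) φ ⟧ (nbhd a i) = R
  ⟦ mod (dia ∋) φ ⟧ (world d)  = d ≤ ⊥'
  ⟦ mod (dia ∋) φ ⟧ (nbhd a i) = (∀ x → ⟦ φ ⟧ (world x) → a ∧' x ≤ i) → R

  -- Denotations as closed and stable down-sets

  mono : ∀ φ {p q} → p ⊑ q → ⟦ φ ⟧ q → ⟦ φ ⟧ p
  mono (var i)         (w t) u       = t ⨟ u
  mono (var i)         (n t) u       = tt
  mono ⊥'              (w t) u       = t ⨟ u
  mono ⊥'              (n t) u       = u
  mono (φ ∧' ψ)        r     (u , v) = mono φ r u , mono ψ r v
  mono (φ ∨' ψ)        (w t) u       = λ c f g → t ⨟ u c f g
  mono (φ ∨' ψ)        (n t) u       = λ c → u (c ∘ [ inj₁ ∘ mono φ (n t) , inj₂ ∘ mono ψ (n t) ])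
  mono (φ ⇒ ψ)         r     f       = λ r′ → f (⊑-trans r′ r)
  mono (mod (box N) φ) (w t) f       = λ a i h → ∧-glb (∧≤ˡ ⨟ t) ∧≤ʳ ⨟ f a i h
  mono (mod (box N) φ) (n t) u       = tt
  mono (mod (box ∋) φ) (w t) u       = tt
  mono (mod (box ∋) φ) (n t) u       = u
  mono (mod (dia N) φ) (w t) u       = λ c f → t ⨟ u c f
  mono (mod (dia N) φ) (n t) u       = u
  mono (mod (dia ∋) φ) (w t) u       = t ⨟ u
  mono (mod (dia ∋) φ) (n t) u       = λ f → u (λ x v → f x v ⨟ t)

  -- Membership in the MacNeille completion: truth at `d` may be tested against upper bounds.
  closed : ∀ φ d → (∀ c → (∀ x → ⟦ φ ⟧ (world x) → x ≤ c) → d ≤ c) → ⟦ φ ⟧ (world d)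
  closed (var i)         d h = h (var i) (λ x t → t)
  closed ⊥'              d h = h ⊥' (λ x t → t)
  closed (φ ∧' ψ)        d h = closed φ d (λ c b → h c (λ x t → b x (proj₁ t)))
                             , closed ψ d (λ c b → h c (λ x t → b x (proj₂ t)))
  closed (φ ∨' ψ)        d h = λ c f g → h c (λ x t → t c f g)
  -- If `c` bounds `ψ`, then `e ⇒ c` bounds `φ ⇒ ψ`, because `φ` holds at `e`.
  closed (φ ⇒ ψ)         d h {world e} (w e≤d) t = closed ψ e λ c b →
    ∧-glb e≤d ≤-refl ⨟ uncurry≤ (h (e ⇒ c) λ x f →
      curry≤ (b (x ∧' e) (f (w ∧≤ˡ) (mono φ (w ∧≤ʳ) t))))
  closed (mod (box N) φ) d h = λ a i ¬u → uncurry≤ (h _ λ x f → curry≤ (f a i ¬u))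
  closed (mod (box ∋) φ) d h = tt
  closed (mod (dia N) φ) d h = λ c f → h c (λ x t → t c f)
  closed (mod (dia ∋) φ) d h = h ⊥' (λ x t → t)

  -- Worlds reduce by `closed` to `≤`, and falsity at neighbourhoods is `R`; this permits proof by
  -- contradiction at every point.
  stable : ∀ φ p → ¬¬ (⟦ φ ⟧ p) → ⟦ φ ⟧ p
  stable φ               (world d)  h = closed φ d λ c b → ≤-stable λ m → h λ t → m (b d t)
  stable (var i)         (nbhd a j) h = tt
  stable ⊥'              (nbhd a i) h = h id
  stable (φ ∧' ψ)        (nbhd a i) h = stable φ _ (λ m → h (m ∘ proj₁))
                                      , stable ψ _ (λ m → h (m ∘ proj₂))
  stable (φ ∨' ψ)        (nbhd a i) h = λ m → h (λ t → t m)
  stable (φ ⇒ ψ)         (nbhd a i) h = λ r t → stable ψ _ (λ m → h (λ f → m (f r t)))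
  stable (mod (box N) φ) (nbhd a i) h = tt
  stable (mod (box ∋) φ) (nbhd a i) h = stable φ (world a) h
  stable (mod (dia N) φ) (nbhd a i) h = h id
  stable (mod (dia ∋) φ) (nbhd a i) h = λ m → h (λ t → t m)

  ⊥-least : ∀ φ p → ⟦ ⊥' ⟧ p → ⟦ φ ⟧ p
  ⊥-least φ (world d)  t = closed φ d (λ c b → t ⨟ ⊥≤)
  ⊥-least φ (nbhd a i) t = stable φ _ (λ _ → t)

  ∨-inj₁ : ∀ φ ψ p → ⟦ φ ⟧ p → ⟦ φ ∨' ψ ⟧ p
  ∨-inj₁ φ ψ (world d)  t = λ c f g → f d t
  ∨-inj₁ φ ψ (nbhd a i) t = λ m → m (inj₁ t)

  ∨-inj₂ : ∀ φ ψ p → ⟦ ψ ⟧ p → ⟦ φ ∨' ψ ⟧ p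
  ∨-inj₂ φ ψ (world d)  t = λ c f g → g d t
  ∨-inj₂ φ ψ (nbhd a i) t = λ m → m (inj₂ t)

  ∨-elim : ∀ φ ψ χ p → ⟦ φ ⇒ χ ⟧ p → ⟦ ψ ⇒ χ ⟧ p → ⟦ φ ∨' ψ ⟧ p → ⟦ χ ⟧ p
  -- `f` and `g` reach only worlds below `d`, so the bound `c` is relativised to `d ⇒ c`.
  ∨-elim φ ψ χ (world d)  f g t = closed χ d λ c b →
    ∧-glb ≤-refl ≤-refl ⨟ uncurry≤ (t (d ⇒ c) (below φ f c b) (below ψ g c b))
    where
    below : ∀ θ → ⟦ θ ⇒ χ ⟧ (world d) → ∀ c → (∀ x → ⟦ χ ⟧ (world x) → x ≤ c) →
            ∀ x → ⟦ θ ⟧ (world x) → x ≤ d ⇒ c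
    below θ h c b x u = curry≤ (b _ (h (w ∧≤ʳ) (mono θ (w ∧≤ˡ) u)))
  ∨-elim φ ψ χ (nbhd a i) f g t = stable χ _ λ m → t (m ∘ [ f ⊑-refl , g ⊑-refl ])

  -- Soundness of IK₂

  soundIPC : ∀ {φ} → IPC φ → ∀ {p} → ⟦ φ ⟧ p
  soundIPC (k φ ψ) = λ _ t r _ → mono φ r t
  soundIPC (s φ ψ χ) = λ _ f r g r′ t → f (⊑-trans r′ r) t ⊑-refl (g r′ t)
  soundIPC (∧e₁ φ ψ) = λ _ → proj₁
  soundIPC (∧e₂ φ ψ) = λ _ → proj₂
  soundIPC (∧i φ ψ) = λ _ t r u → mono φ r t , u
  soundIPC (∨i₁ φ ψ) {_} {q} _ = ∨-inj₁ φ ψ q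
  soundIPC (∨i₂ φ ψ) {_} {q} _ = ∨-inj₂ φ ψ q
  soundIPC (∨e φ ψ χ) = λ _ f r g {q} r′ →
    ∨-elim φ ψ χ q (mono (φ ⇒ χ) (⊑-trans r′ r) f) (mono (ψ ⇒ χ) r′ g)
  soundIPC (efq φ) {_} {q} _ = ⊥-least φ q

  soundK : ∀ j φ ψ {p} → ⟦ □[ j ] (φ ⇒ ψ) ⇒ □[ j ] φ ⇒ □[ j ] ψ ⟧ p
  soundK N φ ψ (w _) f (w e≤d) g = λ a i ¬ψ → ≤-stable λ m →
    m (g a i λ t → m (∧-glb (∧≤ˡ ⨟ e≤d) ∧≤ʳ ⨟ f a i λ h → ¬ψ (h ⊑-refl t)))
  soundK N φ ψ (n _) f (n _) g = tt
  soundK ∋ φ ψ (w _) f (w _) g = tt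
  soundK ∋ φ ψ (n _) f (n _) g = f ⊑-refl g

  soundK◇ : ∀ j φ ψ {p} → ⟦ □[ j ] (φ ⇒ ψ) ⇒ ◇[ j ] φ ⇒ ◇[ j ] ψ ⟧ p
  -- Were `□a ∧ d` not below `c`, then `(a , ⊥')` would refute `φ ⇒ ψ`, which puts `d ∧ □a` below
  -- `◇¬a`; but then `ax□◇` puts it below `⊥'`.
  soundK◇ N φ ψ (w {d} _) f (w e≤d) g = λ c b →
    ∧-glb ≤-refl e≤d ⨟ uncurry≤ (g (d ⇒ c) λ a t → curry≤ (≤-stable λ m →
      m (∧-glb ∧≤ˡ (∧-glb ∧≤ʳ ∧≤ˡ ⨟ f a ⊥' λ h → m (∧≤ˡ ⨟ b a (h ⊑-refl t)))
         ⨟ (λ c → c (ax□◇ a)) ⨟ ⊥≤)))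
  soundK◇ N φ ψ (n _) f (n _) g = g
  soundK◇ ∋ φ ψ (w _) f (w _) g = g
  soundK◇ ∋ φ ψ (n _) f (n _) g = λ m → g λ x t →
    ∧-glb ∧≤ˡ ≤-refl ⨟ m _ (f (w ∧≤ˡ) (mono φ (w ∧≤ʳ) t))

  soundN◇ : ∀ j {p} → ⟦ ¬' (◇[ j ] ⊥') ⟧ p
  soundN◇ N (w _) t = t ⊥' (λ a r → ≤-stable (λ _ → r))
  soundN◇ N (n _) t = t
  soundN◇ ∋ (w _) t = t
  soundN◇ ∋ (n _) t = t (λ x u → ∧≤ʳ ⨟ u ⨟ ⊥≤)

  sound◇∨ : ∀ j φ ψ {p} → ⟦ ◇[ j ] (φ ∨' ψ) ⇒ ◇[ j ] φ ∨' ◇[ j ] ψ ⟧ p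
  sound◇∨ N φ ψ (w _) t = λ c f g → t c λ a h → ≤-stable λ m →
    h (m ∘ [ (λ u → f _ λ c′ b → b a u) , (λ u → g _ λ c′ b → b a u) ])
  sound◇∨ N φ ψ (n _) t = λ _ → t
  sound◇∨ ∋ φ ψ (w _) t = λ c f g → t ⨟ ⊥≤
  -- If the neighbourhood meets neither denotation, `a ⇒ i` bounds both, hence also their join.
  sound◇∨ ∋ φ ψ (n {a} {i} _) t = λ m →
    m (inj₁ λ f → m (inj₂ λ g → t λ x h →
      ∧-glb ∧≤ʳ ∧≤ˡ ⨟ uncurry≤ (h (a ⇒ i) (residual φ f) (residual ψ g))))
    where
    residual : ∀ θ → (∀ x → ⟦ θ ⟧ (world x) → a ∧' x ≤ i) → ∀ x → ⟦ θ ⟧ (world x) → x ≤ a ⇒ i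
    residual θ f x t = curry≤ (∧-glb ∧≤ʳ ∧≤ˡ ⨟ f x t)

  soundFS : ∀ j φ ψ {p} → ⟦ (◇[ j ] φ ⇒ □[ j ] ψ) ⇒ □[ j ] (φ ⇒ ψ) ⟧ p
  -- A refutation of `φ ⇒ ψ` at `(a , i)` yields `j ≤ i` with `φ` true and `ψ` false at `(a , j)`.
  -- Then `φ` passes to `(a , ⊥')`, so `f` applies at the world `d ∧ □a`.
  soundFS N φ ψ (w {d} _) f = λ a i ¬φψ → ≤-stable λ m → ¬φψ λ where
    (n {i = j} j≤i) t → stable ψ _ λ ¬ψ → m
      (∧-glb ≤-refl ∧≤ʳ
       ⨟ f (w ∧≤ˡ) (λ c b → ∧≤ʳ ⨟ b a (mono φ (n ⊥≤) t)) a j ¬ψ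
       ⨟ ◇≤ (curry≤ (uncurry≤ ≤-refl ⨟ j≤i)))
  soundFS N φ ψ (n _) f = tt
  soundFS ∋ φ ψ (w _) f = tt
  -- Either `(a , ⊥')` meets `φ` and `f` applies there, or `x` lies below `⊥'`, where every formula
  -- holds.
  soundFS ∋ φ ψ (n {a} _) f {world x} (w x≤a) t = stable ψ _ λ ¬ψ →
    ¬ψ (mono ψ (w x≤a) (f (n ⊥≤) λ φ⊥ → ¬ψ (⊥-least ψ (world x) (∧-glb x≤a ≤-refl ⨟ φ⊥ x t))))

  soundNec : ∀ j φ → (∀ {p} → ⟦ φ ⟧ p) → ∀ p → ⟦ □[ j ] φ ⟧ p
  soundNec N φ v (world d)  = λ a i ¬φ → ≤-stable (λ _ → ¬φ v)
  soundNec N φ v (nbhd a i) = tt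
  soundNec ∋ φ v (world d)  = tt
  soundNec ∋ φ v (nbhd a i) = v

  sound : ∀ {φ} → ∅ ⊢IK2 φ → ∀ {p} → ⟦ φ ⟧ p
  sound (ipc a)             = soundIPC a
  sound (hyp ())
  sound (axK j φ ψ)         = soundK j φ ψ
  sound (axK◇ j φ ψ)        = soundK◇ j φ ψ
  sound (axN◇ j)            = soundN◇ j
  sound (ax◇∨ j φ ψ)        = sound◇∨ j φ ψ
  sound (axFS j φ ψ)        = soundFS j φ ψ
  sound (mp t u)            = sound t ⊑-refl (sound u)
  sound (nec j {φ} t) {p}   = soundNec j φ (sound t) p

  -- Truth lemma and faithfulness

  truth⇐ : ∀ ψ {d} → d ≤ ψ → ⟦ ψ ᵗ ⟧ (world d)
  truth⇒ : ∀ ψ {d} → ⟦ ψ ᵗ ⟧ (world d) → d ≤ ψ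

  truth⇐ (var i)    t = t
  truth⇐ ⊥'         t = t
  truth⇐ (φ ∧' ψ)   t = truth⇐ φ (t ⨟ ∧≤ˡ) , truth⇐ ψ (t ⨟ ∧≤ʳ)
  truth⇐ (φ ∨' ψ)   t = λ c f g → t ⨟ ∨-lub (f φ (truth⇐ φ ≤-refl)) (g ψ (truth⇐ ψ ≤-refl))
  truth⇐ (φ ⇒ ψ)    t {world e} (w e≤d) u =
    truth⇐ ψ (∧-glb (e≤d ⨟ t) (truth⇒ φ u) ⨟ uncurry≤ ≤-refl)
  truth⇐ (mod □ ψ)  t = λ c b → t ⨟ b ψ (truth⇐ ψ ≤-refl)
  -- The world `ψ` satisfies `ψ ᵗ`, so a neighbourhood that misses it has `ψ ≤ a ⇒ i`.
  truth⇐ (mod ◇ ψ)  t = λ a i h → ≤-stable λ m → h λ f →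
    m (∧≤ˡ ⨟ t ⨟ ◇≤ (curry≤ (∧-glb ∧≤ʳ ∧≤ˡ ⨟ f ψ (truth⇐ ψ ≤-refl))))

  truth⇒ (var i)    t = t
  truth⇒ ⊥'         t = t
  truth⇒ (φ ∧' ψ)   t = ∧-glb (truth⇒ φ (proj₁ t)) (truth⇒ ψ (proj₂ t))
  truth⇒ (φ ∨' ψ)   t = t (φ ∨' ψ) (λ x u → truth⇒ φ u ⨟ λ c → c (ipc (∨i₁ _ _)))
                                   (λ x u → truth⇒ ψ u ⨟ λ c → c (ipc (∨i₂ _ _)))
  truth⇒ (φ ⇒ ψ)    t = curry≤ (truth⇒ ψ (t (w ∧≤ˡ) (truth⇐ φ ∧≤ʳ)))
  truth⇒ (mod □ ψ)  t = t (mod □ ψ) (λ a u → □≤ (truth⇒ ψ u))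
  -- Testing at `(⊤' , ψ)` gives `d ∧ □⊤ ≤ ◇ψ`, and `ax⊤◇` then gives `d ≤ ◇ψ`.
  truth⇒ (mod ◇ ψ)  t =
    curry≤ (t ⊤' ψ (λ h → h λ x u → ∧≤ʳ ⨟ truth⇒ ψ u)
            ⨟ ◇≤ (∧-glb ≤-refl (const≤ ≤-refl) ⨟ uncurry≤ ≤-refl))
    ⨟ λ c → c (ax⊤◇ ψ)

  -- `Γ` may be infinite, but a derivation uses finitely many premises; `d` is their conjunction,
  -- and the conclusion holds at that world.
  soundFrom : ∀ {Γ φ} → (Γ ᵗˢ) ⊢IK2 φ → Σ L□◇ λ d → (Γ ⊢IM d) × ⟦ φ ⟧ (world d)
  soundFrom (ipc a)            = ⊤' , ipc (efq _) , soundIPC a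
  soundFrom (hyp (ψ , h , refl)) = ψ , hyp h , truth⇐ ψ ≤-refl
  soundFrom (axK j φ ψ)        = ⊤' , ipc (efq _) , soundK j φ ψ
  soundFrom (axK◇ j φ ψ)       = ⊤' , ipc (efq _) , soundK◇ j φ ψ
  soundFrom (axN◇ j)           = ⊤' , ipc (efq _) , soundN◇ j
  soundFrom (ax◇∨ j φ ψ)       = ⊤' , ipc (efq _) , sound◇∨ j φ ψ
  soundFrom (axFS j φ ψ)       = ⊤' , ipc (efq _) , soundFS j φ ψ
  soundFrom (mp {φ} t u) with soundFrom t | soundFrom u
  ... | d , Γ⊢d , f | e , Γ⊢e , v =
    d ∧' e , mp (mp (ipc (∧i d e)) Γ⊢d) Γ⊢e , f (w ∧≤ˡ) (mono φ (w ∧≤ʳ) v)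
  soundFrom (nec j {φ} t)      = ⊤' , ipc (efq _) , soundNec j φ (sound t) _

IK2⇒IM : ∀ {Γ} φ → (Γ ᵗˢ) ⊢IK2 φ ᵗ → Γ ⊢IM φ
IK2⇒IM {Γ} φ t with Model.soundFrom (Γ ⊢IM φ) t
-- With `R` as the goal, `d ≤ φ` yields it once each derivation of `d ⇒ φ` does.
... | d , Γ⊢d , u = Model.truth⇒ (Γ ⊢IM φ) φ u λ d⇒φ → mp (weakenIM (λ ()) d⇒φ) Γ⊢d

theorem4p19 : (Γ : FmSet M1) (φ : L□◇) → (Γ ⊢IM φ) ⇔ ((Γ ᵗˢ) ⊢IK2 (φ ᵗ))
theorem4p19 Γ φ = mk⇔ IM⇒IK2 (IK2⇒IM φ)
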